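{- Let $\Gamma$ be a (possibly infinite) set of moded propositions and $P$ a moded proposition. Suppose that for every Kripke model $\mathcal{M}$ (for $\textsc{prk}$) and every world $w$ of $\mathcal{M}$, if $\mathcal{M},w \Vdash Q$ for every $Q\in\Gamma$, then $\mathcal{M},w\Vdash P$. Then $\Gamma\vdash P$ holds in $\textsc{prk}$.
   Context: **Propositions.** Fix a denumerable set of propositional variables $\alpha,\beta,\dots$. Pure propositions: $A,B ::= \alpha \mid A\land B\mid A\lor B\mid \neg A$. (Moded) propositions: $P,Q ::= A^+\mid A^-\mid A^\oplus\mid A^\ominus$ with $A$ pure; $A^+,A^-$ are strong, $A^\oplus,A^\ominus$ are classical. The opposite $P^\sim$ is: $(A^+)^\sim=A^-$, $(A^-)^\sim=A^+$, $(A^\oplus)^\sim=A^\ominus$, $(A^\ominus)^\sim=A^\oplus$. **System $\textsc{prk}$.** Judgments $\Gamma\vdash P$ with $\Gamma$ a finite set of propositions ($\Gamma,P$ means $\Gamma\cup\{P\}$), derivable by the rules (for $i\in\{1,2\}$): - (Ax) $\Gamma,P\vdash P$. (Abs) From $\Gamma\vdash P$ and $\Gamma\vdash P^\sim$ with $P$ strong, infer $\Gamma\vdash Q$ (any $Q$). - (I$\land^+$) From $\Gamma\vdash A^\oplus$ and $\Gamma\vdash B^\oplus$ infer $\Gamma\vdash(A\land B)^+$. (I$\lor^-$) From $\Gamma\vdash A^\ominus$ and $\Gamma\vdash B^\ominus$ infer $\Gamma\vdash(A\lor B)^-$. - (E$\land^+_i$) From $\Gamma\vdash(A_1\land A_2)^+$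 infer $\Gamma\vdash A_i^\oplus$. (E$\lor^-_i$) From $\Gamma\vdash(A_1\lor A_2)^-$ infer $\Gamma\vdash A_i^\ominus$. - (I$\lor^+_i$) From $\Gamma\vdash A_i^\oplus$ infer $\Gamma\vdash(A_1\lor A_2)^+$. (I$\land^-_i$) From $\Gamma\vdash A_i^\ominus$ infer $\Gamma\vdash(A_1\land A_2)^-$. - (E$\lor^+$) From $\Gamma\vdash(A\lor B)^+$, $\Gamma,A^\oplus\vdash P$ and $\Gamma,B^\oplus\vdash P$ infer $\Gamma\vdash P$. (E$\land^-$) From $\Gamma\vdash(A\land B)^-$, $\Gamma,A^\ominus\vdash P$ and $\Gamma,B^\ominus\vdash P$ infer $\Gamma\vdash P$. - (I$\neg^+$) From $\Gamma\vdash A^\ominus$ infer $\Gamma\vdash(\neg A)^+$. (I$\neg^-$) From $\Gamma\vdash A^\oplus$ infer $\Gamma\vdash(\neg A)^-$. (E$\neg^+$) From $\Gamma\vdash(\neg A)^+$ infer $\Gamma\vdash A^\ominus$. (E$\neg^-$) From $\Gamma\vdash(\neg A)^-$ infer $\Gamma\vdash A^\oplus$. - (IC$^+$) From $\Gamma,A^\ominus\vdash A^+$ infer $\Gamma\vdash A^\oplus$. (IC$^-$) From $\Gamma,A^\oplus\vdash A^-$ infer $\Gamma\vdash A^\ominus$. - (EC$^+$) From $\Gamma\vdash A^\oplus$ and $\Gamma\vdash A^\ominus$ infer $\Gamma\vdash A^+$. (EC$^-$) From $\Gamma\vdash A^\ominus$ and $\Gamma\vdash A^\oplus$ infer $\Gamma\vdash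 A^-$. For a possibly infinite set $\Gamma$, $\Gamma\vdash P$ means $\Delta\vdash P$ is derivable for some finite $\Delta\subseteq\Gamma$. **Kripke models.** A Kripke model (for $\textsc{prk}$) is $\mathcal{M}=(\mathcal{W},\le,\mathcal{V}^+,\mathcal{V}^-)$ where $\mathcal{W}$ is a set of worlds, $\le$ is a partial order on $\mathcal{W}$, and for each $w\in\mathcal W$, $\mathcal{V}^+_w$ and $\mathcal{V}^-_w$ are sets of propositional variables such that: (Monotonicity) if $w\le w'$ then $\mathcal V^+_w\subseteq\mathcal V^+_{w'}$ and $\mathcal V^-_w\subseteq\mathcal V^-_{w'}$; (Stabilization) for all $w\in\mathcal W$ and all $\alpha$ there is $w'\ge w$ with $\alpha\in\mathcal V^+_{w'}\,\triangle\,\mathcal V^-_{w'}$ (symmetric difference). **Forcing.** $\mathcal M,w\Vdash P$ is defined by recursion on the measure $\#(A^+)=\#(A^-)=2|A|$, $\#(A^\oplus)=\#(A^\ominus)=2|A|+1$, where $|A|$ is the number of symbols of $A$: - $w\Vdash\alpha^+$ iff $\alpha\in\mathcal V^+_w$; $w\Vdash\alpha^-$ iff $\alpha\in\mathcal V^-_w$; - $w\Vdash(A\land B)^+$ iff $w\Vdash A^\oplus$ and $w\Vdash B^\oplus$; $w\Vdash(A\land B)^-$ iff $w\Vdash A^\ominus$ or $w\Vdash B^\ominus$; - $w\Vdash(A\lor B)^+$ iff $w\Vdash A^\oplus$ or $w\Vdash B^\oplus$; $w\Vdash(A\lor B)^-$ iff $w\Vdash A^\ominus$ and $w\Vdash B^\ominus$;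 - $w\Vdash(\neg A)^+$ iff $w\Vdash A^\ominus$; $w\Vdash(\neg A)^-$ iff $w\Vdash A^\oplus$; - $w\Vdash A^\oplus$ iff $w'\nVdash A^-$ for all $w'\ge w$; $w\Vdash A^\ominus$ iff $w'\nVdash A^+$ for all $w'\ge w$. -}

module Defs where

open import Data.List using (List; _∷_)
open import Data.List.Membership.Propositional using () renaming (_∈_ to _∈ᴸ_)
open import Data.List.Relation.Unary.All using (All)
open import Data.Nat using (ℕ)
open import Data.Product using (_×_; ∃-syntax)
open import Data.Sum using (_⊎_)
open import Level using (0ℓ)
open import Relation.Binary using (Rel; IsPartialOrder)
open import Relation.Binary.PropositionalEquality using (_≡_)
open import Relation.Nullary using (¬_)
open import Relation.Unary using (Pred; _∈_; _⊆_; _∪_; _∖_)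

Var : Set
Var = ℕ

infix  25 ~_
infixr 22 _∧_
infixr 21 _∨_
infix  20 _⁺ _⁻ _⊕ _⊖ _ᵒᵖ
infix  4  _⊢_ _⊢∞_

data Pure : Set where
  var     : Var → Pure
  _∧_ _∨_ : Pure → Pure → Pure
  ~_      : Pure → Pure

data Proposition : Set where
  _⁺ _⁻ _⊕ _⊖ : Pure → Proposition

data Strong : Proposition → Set where
  strong⁺ : ∀ {A} → Strong (A ⁺)
  strong⁻ : ∀ {A} → Strong (A ⁻)

_ᵒᵖ : Proposition → Proposition
(A ⁺) ᵒᵖ = A ⁻
(A ⁻) ᵒᵖ = A ⁺
(A ⊕) ᵒᵖ = A ⊖
(A ⊖) ᵒᵖ = A ⊕

-- Contexts are finite sets of propositions, represented by lists. A context is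
-- only ever inspected through membership (in ax), so order and multiplicity
-- are irrelevant, and P ∷ Γ represents Γ ∪ {P}.
Context : Set
Context = List Proposition

data _⊢_ (Γ : Context) : Proposition → Set where
  ax   : ∀ {P} → P ∈ᴸ Γ → Γ ⊢ P
  abs  : ∀ {P Q} → Strong P → Γ ⊢ P → Γ ⊢ P ᵒᵖ → Γ ⊢ Q

  I∧⁺  : ∀ {A B} → Γ ⊢ A ⊕ → Γ ⊢ B ⊕ → Γ ⊢ (A ∧ B) ⁺
  I∨⁻  : ∀ {A B} → Γ ⊢ A ⊖ → Γ ⊢ B ⊖ → Γ ⊢ (A ∨ B) ⁻
  E∧⁺₁ : ∀ {A B} → Γ ⊢ (A ∧ B) ⁺ → Γ ⊢ A ⊕
  E∧⁺₂ : ∀ {A B} → Γ ⊢ (A ∧ B) ⁺ → Γ ⊢ B ⊕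
  E∨⁻₁ : ∀ {A B} → Γ ⊢ (A ∨ B) ⁻ → Γ ⊢ A ⊖
  E∨⁻₂ : ∀ {A B} → Γ ⊢ (A ∨ B) ⁻ → Γ ⊢ B ⊖

  I∨⁺₁ : ∀ {A B} → Γ ⊢ A ⊕ → Γ ⊢ (A ∨ B) ⁺
  I∨⁺₂ : ∀ {A B} → Γ ⊢ B ⊕ → Γ ⊢ (A ∨ B) ⁺
  I∧⁻₁ : ∀ {A B} → Γ ⊢ A ⊖ → Γ ⊢ (A ∧ B) ⁻
  I∧⁻₂ : ∀ {A B} → Γ ⊢ B ⊖ → Γ ⊢ (A ∧ B) ⁻
  E∨⁺  : ∀ {A B P} → Γ ⊢ (A ∨ B) ⁺ → (A ⊕ ∷ Γ) ⊢ P → (B ⊕ ∷ Γ) ⊢ P → Γ ⊢ P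
  E∧⁻  : ∀ {A B P} → Γ ⊢ (A ∧ B) ⁻ → (A ⊖ ∷ Γ) ⊢ P → (B ⊖ ∷ Γ) ⊢ P → Γ ⊢ P

  I¬⁺  : ∀ {A} → Γ ⊢ A ⊖ → Γ ⊢ (~ A) ⁺
  I¬⁻  : ∀ {A} → Γ ⊢ A ⊕ → Γ ⊢ (~ A) ⁻
  E¬⁺  : ∀ {A} → Γ ⊢ (~ A) ⁺ → Γ ⊢ A ⊖
  E¬⁻  : ∀ {A} → Γ ⊢ (~ A) ⁻ → Γ ⊢ A ⊕

  IC⁺  : ∀ {A} → (A ⊖ ∷ Γ) ⊢ A ⁺ → Γ ⊢ A ⊕
  IC⁻  : ∀ {A} → (A ⊕ ∷ Γ) ⊢ A ⁻ → Γ ⊢ A ⊖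
  EC⁺  : ∀ {A} → Γ ⊢ A ⊕ → Γ ⊢ A ⊖ → Γ ⊢ A ⁺
  EC⁻  : ∀ {A} → Γ ⊢ A ⊖ → Γ ⊢ A ⊕ → Γ ⊢ A ⁻

_⊢∞_ : Pred Proposition 0ℓ → Proposition → Set
Γ ⊢∞ P = ∃[ Δ ] (All (_∈ Γ) Δ × Δ ⊢ P)

_△_ : Pred Var 0ℓ → Pred Var 0ℓ → Pred Var 0ℓ
X △ Y = (X ∖ Y) ∪ (Y ∖ X)

record KripkeModel : Set₁ where
  infix 4 _≤_
  field
    World          : Set
    _≤_            : Rel World 0ℓ
    isPartialOrder : IsPartialOrder _≡_ _≤_
    V⁺ V⁻          : World → Pred Var 0ℓ
    monotone⁺      : ∀ {w w′} → w ≤ w′ → V⁺ w ⊆ V⁺ w′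
    monotone⁻      : ∀ {w w′} → w ≤ w′ → V⁻ w ⊆ V⁻ w′
    stabilization  : ∀ w α → ∃[ w′ ] (w ≤ w′ × α ∈ (V⁺ w′ △ V⁻ w′))

module Forcing (M : KripkeModel) where
  open KripkeModel M

  infix 4 _⊩⁺_ _⊩⁻_ _⊩⊕_ _⊩⊖_ _⊩_

  -- One relation per mode makes the recursion structural in the pure
  -- proposition, in place of recursion on the measure #.
  _⊩⁺_ _⊩⁻_ _⊩⊕_ _⊩⊖_ : World → Pure → Set

  w ⊩⁺ var α = α ∈ V⁺ w
  w ⊩⁺ A ∧ B = w ⊩⊕ A × w ⊩⊕ B
  w ⊩⁺ A ∨ B = w ⊩⊕ A ⊎ w ⊩⊕ B
  w ⊩⁺ ~ A   = w ⊩⊖ A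

  w ⊩⁻ var α = α ∈ V⁻ w
  w ⊩⁻ A ∧ B = w ⊩⊖ A ⊎ w ⊩⊖ B
  w ⊩⁻ A ∨ B = w ⊩⊖ A × w ⊩⊖ B
  w ⊩⁻ ~ A   = w ⊩⊕ A

  w ⊩⊕ A = ∀ w′ → w ≤ w′ → ¬ (w′ ⊩⁻ A)
  w ⊩⊖ A = ∀ w′ → w ≤ w′ → ¬ (w′ ⊩⁺ A)

  _⊩_ : World → Proposition → Set
  w ⊩ (A ⁺) = w ⊩⁺ A
  w ⊩ (A ⁻) = w ⊩⁻ A
  w ⊩ (A ⊕) = w ⊩⊕ A
  w ⊩ (A ⊖) = w ⊩⊖ A

infix 4 _∋_⊩_

_∋_⊩_ : (M : KripkeModel) → KripkeModel.World M → Proposition → Set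
M ∋ w ⊩ P = Forcing._⊩_ M w P

{-# OPTIONS --safe #-}
module Submission where

-- A canonical model argument. The worlds carry saturated theories, obtained by
-- adding one proposition at a time as long as a given proposition stays
-- underivable. The crux is that a saturated theory not containing A ⊕
-- extends to one containing the strong A ⁻: if A ⁻ is refutable then A ⊕ is
-- derivable (refute⁻, and dually refute⁺). For compound A this follows from the
-- introduction rules; for a variable, a strong assumption that leads to
-- a contradiction can be replaced throughout by its classical form.

open import Defs
open import Axiom.ExcludedMiddle using (ExcludedMiddle)
open import Data.List using (List; []; _∷_; _++_; cartesianProductWith; foldl; map; upTo)
open import Data.List.Membership.Propositional using () renaming (_∈_ to _∈ᴸ_)
open import Data.List.Membership.Propositional.Properties
  using (∈-++⁺ˡ; ∈-++⁺ʳ; ∈-cartesianProductWith⁺; ∈-map⁺; ∈-upTo⁺)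
open import Data.List.Relation.Binary.Pointwise using (Pointwise-≡⇒≡; ≡⇒Pointwise-≡)
open import Data.List.Relation.Binary.Subset.Propositional using () renaming (_⊆_ to _⊆ᴸ_)
open import Data.List.Relation.Binary.Subset.Propositional.Properties
  using (∷⁺ʳ; xs⊆x∷xs; xs⊆xs++ys; xs⊆ys++xs)
open import Data.List.Relation.Binary.Suffix.Heterogeneous using (Suffix; here; there)
import Data.List.Relation.Binary.Suffix.Heterogeneous.Properties as Suffix
open import Data.List.Relation.Unary.All as All using (All; []; _∷_)
import Data.List.Relation.Unary.All.Properties as All
open import Data.List.Relation.Unary.Any using (here; there)
open import Data.Nat using (ℕ; zero; suc; _⊔_; _≤_; s≤s; _≤′_; ≤′-refl; ≤′-step)
open import Data.Nat.Properties using (≤⇒≤′; ≤-refl; m≤m⊔n; m≤n⊔m; m⊔n≤o⇒m≤o; m⊔n≤o⇒n≤o)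
open import Data.Product using (_×_; _,_; ∃-syntax)
open import Data.Sum as Sum using (_⊎_; inj₁; inj₂; [_,_]′)
open import Function using (_∘_; id)
open import Level using (0ℓ)
open import Relation.Binary using (IsPartialOrder)
open import Relation.Binary.PropositionalEquality using (_≡_; refl; trans; isEquivalence)
open import Relation.Nullary using (¬_; yes; no; contradiction)
open import Relation.Nullary.Decidable using (decidable-stable)
open import Relation.Unary using (Pred; _∈_; _∉_; _⊆_; _∪_; ｛_｝; ∅)

private variable
  Γ Δ Θ : Context
  A B   : Pure
  P Q Q′ R : Proposition

-- Substitution, weakening and cut.

data Literal : Pred Proposition 0ℓ where
  literal⁺ : ∀ {α} → Literal (var α ⁺)
  literal⁻ : ∀ {α} → Literal (var α ⁻)

○ : Proposition → Proposition
○ (A ⁺) = A ⊕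
○ (A ⁻) = A ⊖
○ (A ⊕) = A ⊕
○ (A ⊖) = A ⊖

-- (Abs) accepts only a strong pair, which (EC⁺) and (EC⁻) extract from the classical one.
clash : Γ ⊢ A ⊕ → Γ ⊢ A ⊖ → Γ ⊢ P
clash d e = abs strong⁺ (EC⁺ d e) (EC⁻ e d)

-- Substitution in which the members of L, which must be literals, need only be
-- available in their classical form. Apart from the side premises of (E∨⁺) and
-- (E∧⁻), only (Abs), (IC⁺) and (IC⁻) can have literal premises, and for these
-- the classical forms suffice; so the conclusion survives, up to the same relaxation.
module Substitution (L : Pred Proposition 0ℓ) (L⊆Literal : L ⊆ Literal) where

  infix 4 _⊢ᴸ_ _⇒_

  _⊢ᴸ_ : Context → Proposition → Set
  Γ ⊢ᴸ P = Γ ⊢ P ⊎ (P ∈ L × Γ ⊢ ○ P)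

  -- Quantifying over the extensions Θ makes weakening an instance of substitution.
  _⇒_ : Context → Context → Set
  Γ ⇒ Δ = ∀ {P Θ} → P ∈ᴸ Γ → Δ ⊆ᴸ Θ → Θ ⊢ᴸ P

  extend : Γ ⇒ Δ → Γ ⇒ (P ∷ Δ)
  extend σ P∈Γ Δ⊆Θ = σ P∈Γ (Δ⊆Θ ∘ there)

  lift : Γ ⇒ Δ → (P ∷ Γ) ⇒ (P ∷ Δ)
  lift σ (here refl)  Δ⊆Θ = inj₁ (ax (Δ⊆Θ (here refl)))
  lift σ (there P∈Γ) Δ⊆Θ = extend σ P∈Γ Δ⊆Θ

  strict : ¬ Literal P → Γ ⊢ᴸ P → Γ ⊢ P
  strict ¬lit (inj₁ d)       = d
  strict ¬lit (inj₂ (l , _)) = contradiction (L⊆Literal l) ¬lit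

  -- The hypothesis `A ⊖`, which (IC⁺) will discharge, is just what (EC⁺) needs to turn `A ⊕` back
  -- into `A ⁺`.
  strict⁺ : (A ⊖ ∷ Γ) ⊢ᴸ A ⁺ → (A ⊖ ∷ Γ) ⊢ A ⁺
  strict⁺ (inj₁ d)       = d
  strict⁺ (inj₂ (_ , c)) = EC⁺ c (ax (here refl))

  strict⁻ : (A ⊕ ∷ Γ) ⊢ᴸ A ⁻ → (A ⊕ ∷ Γ) ⊢ A ⁻
  strict⁻ (inj₁ d)       = d
  strict⁻ (inj₂ (_ , c)) = EC⁻ c (ax (here refl))

  -- `f` is an elimination rule with its major premise fixed. Its branches must agree, so once one
  -- is relaxed both are taken at `○ P`.
  combine : (∀ {R} → Γ ⊢ R → Δ ⊢ R → Θ ⊢ R) →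
            Γ ⊢ᴸ P → Δ ⊢ᴸ P → Γ ⊢ ○ P → Δ ⊢ ○ P → Θ ⊢ᴸ P
  combine f (inj₁ d)       (inj₁ e)       _  _  = inj₁ (f d e)
  combine f (inj₂ (l , _)) _              d○ e○ = inj₂ (l , f d○ e○)
  combine f _              (inj₂ (l , _)) d○ e○ = inj₂ (l , f d○ e○)

  substitute  : Γ ⇒ Δ → Γ ⊢ P → Δ ⊢ᴸ P
  substitute○ : Γ ⇒ Δ → Γ ⊢ P → Δ ⊢ ○ P

  substitute σ (ax P∈Γ)            = σ P∈Γ id
  substitute σ (abs strong⁺ d e)   = inj₁ (clash (substitute○ σ d) (substitute○ σ e))
  substitute σ (abs strong⁻ d e)   = inj₁ (clash (substitute○ σ e) (substitute○ σ d))
  substitute σ (I∧⁺ d e)           = inj₁ (I∧⁺ (substitute○ σ d) (substitute○ σ e))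
  substitute σ (I∨⁻ d e)           = inj₁ (I∨⁻ (substitute○ σ d) (substitute○ σ e))
  substitute σ (E∧⁺₁ d)            = inj₁ (E∧⁺₁ (strict (λ ()) (substitute σ d)))
  substitute σ (E∧⁺₂ d)            = inj₁ (E∧⁺₂ (strict (λ ()) (substitute σ d)))
  substitute σ (E∨⁻₁ d)            = inj₁ (E∨⁻₁ (strict (λ ()) (substitute σ d)))
  substitute σ (E∨⁻₂ d)            = inj₁ (E∨⁻₂ (strict (λ ()) (substitute σ d)))
  substitute σ (I∨⁺₁ d)            = inj₁ (I∨⁺₁ (substitute○ σ d))
  substitute σ (I∨⁺₂ d)            = inj₁ (I∨⁺₂ (substitute○ σ d))
  substitute σ (I∧⁻₁ d)            = inj₁ (I∧⁻₁ (substitute○ σ d))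
  substitute σ (I∧⁻₂ d)            = inj₁ (I∧⁻₂ (substitute○ σ d))
  substitute σ (E∨⁺ c d e)         =
    combine (E∨⁺ (strict (λ ()) (substitute σ c)))
      (substitute (lift σ) d) (substitute (lift σ) e)
      (substitute○ (lift σ) d) (substitute○ (lift σ) e)
  substitute σ (E∧⁻ c d e)         =
    combine (E∧⁻ (strict (λ ()) (substitute σ c)))
      (substitute (lift σ) d) (substitute (lift σ) e)
      (substitute○ (lift σ) d) (substitute○ (lift σ) e)
  substitute σ (I¬⁺ d)             = inj₁ (I¬⁺ (substitute○ σ d))
  substitute σ (I¬⁻ d)             = inj₁ (I¬⁻ (substitute○ σ d))
  substitute σ (E¬⁺ d)             = inj₁ (E¬⁺ (strict (λ ()) (substitute σ d)))
  substitute σ (E¬⁻ d)             = inj₁ (E¬⁻ (strict (λ ()) (substitute σ d)))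
  substitute σ (IC⁺ d)             = inj₁ (IC⁺ (strict⁺ (substitute (lift σ) d)))
  substitute σ (IC⁻ d)             = inj₁ (IC⁻ (strict⁻ (substitute (lift σ) d)))
  substitute σ (EC⁺ d e)           = inj₁ (EC⁺ (substitute○ σ d) (substitute○ σ e))
  substitute σ (EC⁻ d e)           = inj₁ (EC⁻ (substitute○ σ d) (substitute○ σ e))

  -- The same derivation is replayed under an extra hypothesis `A ⊖`, which repairs a relaxed
  -- conclusion and is then discharged.
  substitute○ {P = _ ⁺} σ d = IC⁺ (strict⁺ (substitute (extend σ) d))
  substitute○ {P = _ ⁻} σ d = IC⁻ (strict⁻ (substitute (extend σ) d))
  substitute○ {P = _ ⊕} σ d = strict (λ ()) (substitute σ d)
  substitute○ {P = _ ⊖} σ d = strict (λ ()) (substitute σ d)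

module _ where
  -- With no literal relaxed, `Γ ⊢ᴸ P` amounts to `Γ ⊢ P`, and ordinary substitution results.
  open Substitution ∅ (λ ())

  private
    unrelaxed : Γ ⊢ᴸ P → Γ ⊢ P
    unrelaxed (inj₁ d)        = d
    unrelaxed (inj₂ (() , _))

  weaken : Γ ⊆ᴸ Δ → Γ ⊢ P → Δ ⊢ P
  weaken Γ⊆Δ d = unrelaxed (substitute (λ P∈Γ Δ⊆Θ → inj₁ (ax (Δ⊆Θ (Γ⊆Δ P∈Γ)))) d)

  cut : Δ ⊢ P → Γ ⊆ᴸ Δ → (P ∷ Γ) ⊢ Q → Δ ⊢ Q
  cut {Δ = Δ} {P = P} {Γ = Γ} c Γ⊆Δ d = unrelaxed (substitute σ d)
    where
    σ : (P ∷ Γ) ⇒ Δ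
    σ (here refl)  Δ⊆Θ = inj₁ (weaken Δ⊆Θ c)
    σ (there Q∈Γ) Δ⊆Θ = inj₁ (ax (Δ⊆Θ (Γ⊆Δ Q∈Γ)))

  ○-intro : Γ ⊢ P → Γ ⊢ ○ P
  ○-intro = substitute○ (λ P∈Γ Γ⊆Θ → inj₁ (ax (Γ⊆Θ P∈Γ)))

-- Refutation of strong propositions.

-- A substitute for falsum, absent from the syntax. Not being a literal, it is never relaxed by
-- substitution.
⊥ᵖ : Proposition
⊥ᵖ = (var 0 ∧ ~ var 0) ⁺

⊥ᵖ-elim : Γ ⊢ ⊥ᵖ → Γ ⊢ P
⊥ᵖ-elim d = clash (E∧⁺₂ d) (○-intro (I¬⁻ (E∧⁺₁ d)))

⊕-by-contradiction : (A ⊖ ∷ Γ) ⊢ ⊥ᵖ → Γ ⊢ A ⊕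
⊕-by-contradiction d = IC⁺ (⊥ᵖ-elim d)

⊖-by-contradiction : (A ⊕ ∷ Γ) ⊢ ⊥ᵖ → Γ ⊢ A ⊖
⊖-by-contradiction d = IC⁻ (⊥ᵖ-elim d)

relax-literal : Literal P → (P ∷ Γ) ⊢ ⊥ᵖ → (○ P ∷ Γ) ⊢ ⊥ᵖ
relax-literal {P} {Γ} lit d = strict (λ ()) (substitute σ d)
  where
  open Substitution Literal id
  σ : (P ∷ Γ) ⇒ (○ P ∷ Γ)
  σ (here refl)  Γ⊆Θ = inj₂ (lit , ax (Γ⊆Θ (here refl)))
  σ (there R∈Γ) Γ⊆Θ = inj₁ (ax (Γ⊆Θ (there R∈Γ)))

refute⁺ : ∀ A → (A ⁺ ∷ Γ) ⊢ ⊥ᵖ → Γ ⊢ A ⊖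
refute⁺ (var α) d = ⊖-by-contradiction (relax-literal literal⁺ d)
refute⁺ (A ∧ B) d =
  -- Which conjunct fails is unknown. The assumption `(A ∧ B) ⊕` from (IC⁻) allows a commitment to
  -- `B ⊖` first and, under `B ⊕`, a switch to `A ⊖` that clashes with it; `d` is applied once both
  -- `A ⊕` and `B ⊕` are assumed.
  IC⁻ (I∧⁻₂ (⊖-by-contradiction
    (clash (ax (there (here refl)))
      (○-intro (I∧⁻₁ (⊖-by-contradiction
        (cut (I∧⁺ (ax (here refl)) (ax (there (here refl)))) (λ R∈Γ → there (there (there R∈Γ))) d)))))))
refute⁺ (A ∨ B) d =
  ○-intro (I∨⁻
    (⊖-by-contradiction (cut (I∨⁺₁ (ax (here refl))) there d))
    (⊖-by-contradiction (cut (I∨⁺₂ (ax (here refl))) there d)))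
refute⁺ (~ A) d =
  ○-intro (I¬⁻ (⊕-by-contradiction (cut (I¬⁺ (ax (here refl))) there d)))

refute⁻ : ∀ A → (A ⁻ ∷ Γ) ⊢ ⊥ᵖ → Γ ⊢ A ⊕
refute⁻ (var α) d = ⊕-by-contradiction (relax-literal literal⁻ d)
refute⁻ (A ∧ B) d =
  ○-intro (I∧⁺
    (⊕-by-contradiction (cut (I∧⁻₁ (ax (here refl))) there d))
    (⊕-by-contradiction (cut (I∧⁻₂ (ax (here refl))) there d)))
refute⁻ (A ∨ B) d =
  IC⁺ (I∨⁺₂ (⊕-by-contradiction
    (clash
      (○-intro (I∨⁺₁ (⊕-by-contradiction
        (cut (I∨⁻ (ax (here refl)) (ax (there (here refl)))) (λ R∈Γ → there (there (there R∈Γ))) d))))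
      (ax (there (here refl))))))
refute⁻ (~ A) d =
  ○-intro (I¬⁺ (⊖-by-contradiction (cut (I¬⁻ (ax (here refl))) there d)))

-- Derivability from infinite sets, and saturation.

private variable
  S T : Pred Proposition 0ℓ

⊢∞-mono : S ⊆ T → S ⊢∞ P → T ⊢∞ P
⊢∞-mono S⊆T (Δ , Δ⊆S , d) = Δ , All.map S⊆T Δ⊆S , d

∈⇒⊢∞ : P ∈ S → S ⊢∞ P
∈⇒⊢∞ P∈S = _ , P∈S ∷ [] , ax (here refl)

discharge : S ∪ ｛ Q ｝ ⊢∞ P → ∃[ Δ ] (All (_∈ S) Δ × (Q ∷ Δ) ⊢ P)
discharge {S} {Q} (_ , ps , d) = let Δ , Δ⊆S , Γ⊆ = split ps in Δ , Δ⊆S , weaken Γ⊆ d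
  where
  split : All (_∈ S ∪ ｛ Q ｝) Γ → ∃[ Γ′ ] (All (_∈ S) Γ′ × Γ ⊆ᴸ Q ∷ Γ′)
  split [] = [] , [] , λ ()
  split (inj₁ R∈S ∷ ps) with Γ′ , Γ′⊆S , Γ⊆ ← split ps =
    _ ∷ Γ′ , R∈S ∷ Γ′⊆S ,
    λ { (here refl) → there (here refl) ; (there r) → ∷⁺ʳ Q (xs⊆x∷xs Γ′ _) (Γ⊆ r) }
  split (inj₂ refl ∷ ps) with Γ′ , Γ′⊆S , Γ⊆ ← split ps =
    Γ′ , Γ′⊆S , λ { (here refl) → here refl ; (there r) → Γ⊆ r }

⊢∞-cut : S ⊢∞ Q → S ∪ ｛ Q ｝ ⊢∞ P → S ⊢∞ P
⊢∞-cut (Γ , Γ⊆S , d) e with Δ , Δ⊆S , e′ ← discharge e =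
  Γ ++ Δ , All.++⁺ Γ⊆S Δ⊆S , cut (weaken (xs⊆xs++ys Γ Δ) d) (xs⊆ys++xs Δ Γ) e′

-- Primeness is asked exactly where forcing a strong proposition is a disjunction.
record Saturated (T : Pred Proposition 0ℓ) : Set where
  field
    closed     : T ⊢∞ P → P ∈ T
    consistent : ⊥ᵖ ∉ T
    prime∨     : (A ∨ B) ⁺ ∈ T → A ⊕ ∈ T ⊎ B ⊕ ∈ T
    prime∧     : (A ∧ B) ⁻ ∈ T → A ⊖ ∈ T ⊎ B ⊖ ∈ T

-- Enumeration of the propositions.

depth : Pure → ℕ
-- Counting the index leaves only finitely many pure propositions up to each depth.
depth (var α) = suc α
depth (A ∧ B) = suc (depth A ⊔ depth B)
depth (A ∨ B) = suc (depth A ⊔ depth B)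
depth (~ A)   = suc (depth A)

pures : ℕ → List Pure
pures zero    = []
pures (suc n) =
  map var (upTo (suc n)) ++
  cartesianProductWith _∧_ (pures n) (pures n) ++
  cartesianProductWith _∨_ (pures n) (pures n) ++
  map ~_ (pures n)

∈-pures : ∀ A {n} → depth A ≤ n → A ∈ᴸ pures n
∈-pures (var α) {suc n} le = ∈-++⁺ˡ (∈-map⁺ var (∈-upTo⁺ le))
∈-pures (A ∧ B) {suc n} (s≤s le) =
  ∈-++⁺ʳ (map var (upTo (suc n))) (∈-++⁺ˡ
    (∈-cartesianProductWith⁺ _∧_
      (∈-pures A (m⊔n≤o⇒m≤o _ _ le)) (∈-pures B (m⊔n≤o⇒n≤o _ _ le))))
∈-pures (A ∨ B) {suc n} (s≤s le) =
  ∈-++⁺ʳ (map var (upTo (suc n))) (∈-++⁺ʳ (cartesianProductWith _∧_ (pures n) (pures n)) (∈-++⁺ˡ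
    (∈-cartesianProductWith⁺ _∨_
      (∈-pures A (m⊔n≤o⇒m≤o _ _ le)) (∈-pures B (m⊔n≤o⇒n≤o _ _ le)))))
∈-pures (~ A) {suc n} (s≤s le) =
  ∈-++⁺ʳ (map var (upTo (suc n))) (∈-++⁺ʳ (cartesianProductWith _∧_ (pures n) (pures n))
    (∈-++⁺ʳ (cartesianProductWith _∨_ (pures n) (pures n)) (∈-map⁺ ~_ (∈-pures A le))))

propositions : ℕ → List Proposition
propositions n = map _⁺ (pures n) ++ map _⁻ (pures n) ++ map _⊕ (pures n) ++ map _⊖ (pures n)

∈-propositions : ∀ P → ∃[ n ] P ∈ᴸ propositions n
∈-propositions (A ⁺) = depth A , ∈-++⁺ˡ (∈-map⁺ _⁺ (∈-pures A ≤-refl))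
∈-propositions (A ⁻) = depth A ,
  ∈-++⁺ʳ (map _⁺ (pures (depth A))) (∈-++⁺ˡ (∈-map⁺ _⁻ (∈-pures A ≤-refl)))
∈-propositions (A ⊕) = depth A ,
  ∈-++⁺ʳ (map _⁺ (pures (depth A))) (∈-++⁺ʳ (map _⁻ (pures (depth A)))
    (∈-++⁺ˡ (∈-map⁺ _⊕ (∈-pures A ≤-refl))))
∈-propositions (A ⊖) = depth A ,
  ∈-++⁺ʳ (map _⁺ (pures (depth A))) (∈-++⁺ʳ (map _⁻ (pures (depth A)))
    (∈-++⁺ʳ (map _⊕ (pures (depth A))) (∈-map⁺ _⊖ (∈-pures A ≤-refl))))

-- Saturation avoiding a given proposition.

module Lindenbaum (em : ExcludedMiddle 0ℓ) (P : Proposition) where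

  -- The test for adding `Q` sits inside the membership predicate, so the construction itself
  -- decides nothing; excluded middle enters only in proofs about it.
  add : Pred Proposition 0ℓ → Proposition → Pred Proposition 0ℓ
  add S Q = S ∪ λ R → Q ≡ R × ¬ (S ∪ ｛ Q ｝ ⊢∞ P)

  add-avoids : ¬ (S ⊢∞ P) → ¬ (add S Q ⊢∞ P)
  add-avoids {S} {Q} S⊬P d with em {S ∪ ｛ Q ｝ ⊢∞ P}
  ... | yes e = S⊬P (⊢∞-mono [ id , (λ (_ , ¬e) → contradiction e ¬e) ]′ d)
  ... | no ¬e = ¬e (⊢∞-mono [ inj₁ , (λ (eq , _) → inj₂ eq) ]′ d)

  stage : Pred Proposition 0ℓ → ℕ → Pred Proposition 0ℓ
  stage S zero    = S
  stage S (suc n) = foldl add (stage S n) (propositions n)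

  saturate : Pred Proposition 0ℓ → Pred Proposition 0ℓ
  saturate S Q = ∃[ n ] Q ∈ stage S n

  foldl-extends : ∀ Γ → R ∈ S → R ∈ foldl add S Γ
  foldl-extends []      = id
  foldl-extends (Q ∷ Γ) = foldl-extends Γ ∘ inj₁

  foldl-avoids : ∀ Γ → ¬ (S ⊢∞ P) → ¬ (foldl add S Γ ⊢∞ P)
  foldl-avoids []      S⊬P = S⊬P
  foldl-avoids (Q ∷ Γ) S⊬P = foldl-avoids Γ (add-avoids S⊬P)

  -- When `Q` is reached, the set built so far lies within `T`. Hence it too avoids `P` after adding
  -- `Q`, and the test succeeds.
  foldl-maximal : foldl add S Γ ⊆ T → ¬ (T ∪ ｛ Q ｝ ⊢∞ P) → Q ∈ᴸ Γ → Q ∈ T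
  foldl-maximal {S} {R ∷ Γ} S⊆T T⊬P (here refl) =
    S⊆T (foldl-extends Γ (inj₂ (refl , T⊬P ∘ ⊢∞-mono
      [ inj₁ ∘ S⊆T ∘ foldl-extends Γ ∘ inj₁ , inj₂ ]′)))
  foldl-maximal S⊆T T⊬P (there Q∈Γ) = foldl-maximal S⊆T T⊬P Q∈Γ

  stage-mono : ∀ {m n} → m ≤′ n → stage S m ⊆ stage S n
  stage-mono ≤′-refl       Q∈ = Q∈
  stage-mono (≤′-step {n} m≤n) Q∈ = foldl-extends (propositions n) (stage-mono m≤n Q∈)

  stage-avoids : ¬ (S ⊢∞ P) → ∀ n → ¬ (stage S n ⊢∞ P)
  stage-avoids S⊬P zero    = S⊬P
  stage-avoids S⊬P (suc n) = foldl-avoids (propositions n) (stage-avoids S⊬P n)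

  saturate-compact : All (_∈ saturate S) Γ → ∃[ n ] All (_∈ stage S n) Γ
  saturate-compact []             = 0 , []
  saturate-compact ((m , Q∈) ∷ ps) with n , qs ← saturate-compact ps =
    m ⊔ n , stage-mono (≤⇒≤′ (m≤m⊔n m n)) Q∈ ∷ All.map (stage-mono (≤⇒≤′ (m≤n⊔m m n))) qs

  saturate-extends : S ⊆ saturate S
  saturate-extends = 0 ,_

  saturate-avoids : ¬ (S ⊢∞ P) → ¬ (saturate S ⊢∞ P)
  saturate-avoids S⊬P (Δ , Δ⊆ , d) with n , Δ⊆stage ← saturate-compact Δ⊆ =
    stage-avoids S⊬P n (Δ , Δ⊆stage , d)

  saturate-maximal : ¬ (saturate S ∪ ｛ Q ｝ ⊢∞ P) → Q ∈ saturate S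
  saturate-maximal {Q = Q} ⊬P with n , Q∈ ← ∈-propositions Q = foldl-maximal (suc n ,_) ⊬P Q∈

  -- `rule` is (E∨⁺) or (E∧⁻) with conclusion `P`. Were both disjuncts rejected by maximality, each
  -- would yield `P`, and so would `R`.
  saturate-prime : ¬ (S ⊢∞ P) →
                   (∀ {Γ} → Γ ⊢ R → (Q ∷ Γ) ⊢ P → (Q′ ∷ Γ) ⊢ P → Γ ⊢ P) →
                   R ∈ saturate S → Q ∈ saturate S ⊎ Q′ ∈ saturate S
  saturate-prime {S} {R} {Q} {Q′} S⊬P rule R∈
    with em {saturate S ∪ ｛ Q ｝ ⊢∞ P} | em {saturate S ∪ ｛ Q′ ｝ ⊢∞ P}
  ... | no ¬d | _     = inj₁ (saturate-maximal ¬d)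
  ... | yes _ | no ¬e = inj₂ (saturate-maximal ¬e)
  ... | yes d | yes e
    with Γ , Γ⊆ , d′ ← discharge d | Δ , Δ⊆ , e′ ← discharge e =
    contradiction
      ( R ∷ Γ ++ Δ , R∈ ∷ All.++⁺ Γ⊆ Δ⊆
      , rule (ax (here refl))
          (weaken (∷⁺ʳ Q (there ∘ xs⊆xs++ys Γ Δ)) d′)
          (weaken (∷⁺ʳ Q′ (there ∘ xs⊆ys++xs Δ Γ)) e′))
      (saturate-avoids S⊬P)

  saturate-saturated : ¬ (S ⊢∞ P) → Saturated (saturate S)
  saturate-saturated S⊬P = record
    { closed     = λ d → saturate-maximal (saturate-avoids S⊬P ∘ ⊢∞-cut d)
    ; consistent = λ ⊥∈ → saturate-avoids S⊬P (_ , ⊥∈ ∷ [] , ⊥ᵖ-elim (ax (here refl)))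
    ; prime∨     = saturate-prime S⊬P E∨⁺
    ; prime∧     = saturate-prime S⊬P E∧⁻
    }

-- The canonical model.

module _ (em : ExcludedMiddle 0ℓ) where
  open Lindenbaum em

  -- Only the root has to avoid `P`; later worlds need only be consistent. If `Q` is inconsistent
  -- with `w`, `add` contributes nothing, so every list still names a saturated theory.
  theory : Pred Proposition 0ℓ → Proposition → List Proposition → Pred Proposition 0ℓ
  theory S P []      = saturate P S
  theory S P (Q ∷ w) = saturate ⊥ᵖ (add ⊥ᵖ (theory S P w) Q)

  theory-saturated : ¬ (S ⊢∞ P) → ∀ w → Saturated (theory S P w)
  theory-saturated S⊬P []      = saturate-saturated _ S⊬P
  theory-saturated S⊬P (Q ∷ w) = saturate-saturated ⊥ᵖ (add-avoids ⊥ᵖ (consistent ∘ closed))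
    where open Saturated (theory-saturated S⊬P w)

-- World Q ∷ w is the extension of w by Q, when Q is consistent with w. Naming
-- the worlds by lists, ordered by suffix, makes the order antisymmetric.
module Canonical
  (em : ExcludedMiddle 0ℓ)
  (theory : List Proposition → Pred Proposition 0ℓ)
  (theory-saturated : ∀ w → Saturated (theory w))
  (theory-⊆ : ∀ {w Q} → theory w ⊆ theory (Q ∷ w))
  (∈-theory-∷ : ∀ {w Q} → ¬ (theory w ∪ ｛ Q ｝ ⊢∞ ⊥ᵖ) → Q ∈ theory (Q ∷ w))
  where

  module _ {w : List Proposition} where
    open Saturated (theory-saturated w) public

  _≤ʷ_ : List Proposition → List Proposition → Set
  _≤ʷ_ = Suffix _≡_

  ≤ʷ-isPartialOrder : IsPartialOrder _≡_ _≤ʷ_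
  ≤ʷ-isPartialOrder = record
    { isPreorder = record
      { isEquivalence = isEquivalence
      ; reflexive     = here ∘ ≡⇒Pointwise-≡
      ; trans         = Suffix.trans trans
      }
    ; antisym = λ w≤v v≤w → Pointwise-≡⇒≡ (Suffix.antisym (λ eq _ → eq) w≤v v≤w)
    }

  theory-mono : ∀ {w v} → w ≤ʷ v → theory w ⊆ theory v
  theory-mono (here eqs) with refl ← Pointwise-≡⇒≡ eqs = id
  theory-mono (there w≤v) = theory-⊆ ∘ theory-mono w≤v

  ≤ʷ-∷ : ∀ {w Q} → w ≤ʷ (Q ∷ w)
  ≤ʷ-∷ = there (here (≡⇒Pointwise-≡ refl))

  derive₁ : ∀ {w} → P ∈ theory w → (P ∷ []) ⊢ Q → Q ∈ theory w
  derive₁ p d = closed (_ , p ∷ [] , d)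

  derive₂ : ∀ {w} → P ∈ theory w → Q ∈ theory w → (P ∷ Q ∷ []) ⊢ R → R ∈ theory w
  derive₂ p q d = closed (_ , p ∷ q ∷ [] , d)

  ⊕-⊖-exclusive : ∀ {w} → A ⊕ ∈ theory w → A ⊖ ∉ theory w
  ⊕-⊖-exclusive p q = consistent (derive₂ p q (clash (ax (here refl)) (ax (there (here refl)))))

  ⁺⇒⊕ : ∀ {w} → A ⁺ ∈ theory w → A ⊕ ∈ theory w
  ⁺⇒⊕ p = derive₁ p (○-intro (ax (here refl)))

  ⁻⇒⊖ : ∀ {w} → A ⁻ ∈ theory w → A ⊖ ∈ theory w
  ⁻⇒⊖ p = derive₁ p (○-intro (ax (here refl)))

  -- Contrapositive of `refute⁺`: if `A ⁺` were inconsistent with the theory, closure would put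
  -- `A ⊖` in it.
  ∉⊖⇒∈⁺ : ∀ {w} → A ⊖ ∉ theory w → A ⁺ ∈ theory (A ⁺ ∷ w)
  ∉⊖⇒∈⁺ ∉ = ∈-theory-∷ λ d → let Δ , Δ⊆ , e = discharge d in ∉ (closed (Δ , Δ⊆ , refute⁺ _ e))

  ∉⊕⇒∈⁻ : ∀ {w} → A ⊕ ∉ theory w → A ⁻ ∈ theory (A ⁻ ∷ w)
  ∉⊕⇒∈⁻ ∉ = ∈-theory-∷ λ d → let Δ , Δ⊆ , e = discharge d in ∉ (closed (Δ , Δ⊆ , refute⁻ _ e))

  stabilize : ∀ w α → ∃[ v ] (w ≤ʷ v × α ∈
    ((λ β → var β ⁺ ∈ theory v) △ (λ β → var β ⁻ ∈ theory v)))
  stabilize w α with em {var α ⊕ ∈ theory w}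
  ... | yes p =
    var α ⁺ ∷ w , ≤ʷ-∷ ,
    -- `var α ⊕` persists to the new world, where `var α ⁻` would give the opposite `var α ⊖`.
    inj₁ (∉⊖⇒∈⁺ (⊕-⊖-exclusive p) , λ q → ⊕-⊖-exclusive (theory-mono ≤ʷ-∷ p) (⁻⇒⊖ q))
  ... | no ¬p =
    var α ⁻ ∷ w , ≤ʷ-∷ , inj₂ (∉⊕⇒∈⁻ ¬p , λ q → ⊕-⊖-exclusive (⁺⇒⊕ q) (⁻⇒⊖ (∉⊕⇒∈⁻ ¬p)))

  model : KripkeModel
  model = record
    { World          = List Proposition
    ; _≤_            = _≤ʷ_
    ; isPartialOrder = ≤ʷ-isPartialOrder
    ; V⁺             = λ w α → var α ⁺ ∈ theory w
    ; V⁻             = λ w α → var α ⁻ ∈ theory w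
    ; monotone⁺      = λ w≤v → theory-mono w≤v
    ; monotone⁻      = λ w≤v → theory-mono w≤v
    ; stabilization  = stabilize
    }

  -- The truth lemma.

  open Forcing model

  -- Both directions are proved together because classical forcing negates the opposite strong
  -- forcing. Classical cases call strong ones at the same `A`, and strong ones call classical ones
  -- at its parts, so the recursion is well founded.
  force⁺   : ∀ A {w} → A ⁺ ∈ theory w → w ⊩⁺ A
  force⁻   : ∀ A {w} → A ⁻ ∈ theory w → w ⊩⁻ A
  force⊕   : ∀ A {w} → A ⊕ ∈ theory w → w ⊩⊕ A
  force⊖   : ∀ A {w} → A ⊖ ∈ theory w → w ⊩⊖ A
  reflect⁺ : ∀ A {w} → w ⊩⁺ A → A ⁺ ∈ theory w
  reflect⁻ : ∀ A {w} → w ⊩⁻ A → A ⁻ ∈ theory w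
  reflect⊕ : ∀ A {w} → w ⊩⊕ A → A ⊕ ∈ theory w
  reflect⊖ : ∀ A {w} → w ⊩⊖ A → A ⊖ ∈ theory w

  force⁺ (var α) p = p
  force⁺ (A ∧ B) p =
    force⊕ A (derive₁ p (E∧⁺₁ (ax (here refl)))) , force⊕ B (derive₁ p (E∧⁺₂ (ax (here refl))))
  force⁺ (A ∨ B) p = Sum.map (force⊕ A) (force⊕ B) (prime∨ p)
  force⁺ (~ A)   p = force⊖ A (derive₁ p (E¬⁺ (ax (here refl))))

  force⁻ (var α) p = p
  force⁻ (A ∧ B) p = Sum.map (force⊖ A) (force⊖ B) (prime∧ p)
  force⁻ (A ∨ B) p =
    force⊖ A (derive₁ p (E∨⁻₁ (ax (here refl)))) , force⊖ B (derive₁ p (E∨⁻₂ (ax (here refl))))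
  force⁻ (~ A)   p = force⊕ A (derive₁ p (E¬⁻ (ax (here refl))))

  force⊕ A p v w≤v f = ⊕-⊖-exclusive (theory-mono w≤v p) (⁻⇒⊖ (reflect⁻ A f))
  force⊖ A p v w≤v f = ⊕-⊖-exclusive (⁺⇒⊕ (reflect⁺ A f)) (theory-mono w≤v p)

  reflect⁺ (var α) f        = f
  reflect⁺ (A ∧ B) (f , g)  =
    derive₂ (reflect⊕ A f) (reflect⊕ B g) (I∧⁺ (ax (here refl)) (ax (there (here refl))))
  reflect⁺ (A ∨ B) (inj₁ f) = derive₁ (reflect⊕ A f) (I∨⁺₁ (ax (here refl)))
  reflect⁺ (A ∨ B) (inj₂ g) = derive₁ (reflect⊕ B g) (I∨⁺₂ (ax (here refl)))
  reflect⁺ (~ A)   f        = derive₁ (reflect⊖ A f) (I¬⁺ (ax (here refl)))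

  reflect⁻ (var α) f        = f
  reflect⁻ (A ∧ B) (inj₁ f) = derive₁ (reflect⊖ A f) (I∧⁻₁ (ax (here refl)))
  reflect⁻ (A ∧ B) (inj₂ g) = derive₁ (reflect⊖ B g) (I∧⁻₂ (ax (here refl)))
  reflect⁻ (A ∨ B) (f , g)  =
    derive₂ (reflect⊖ A f) (reflect⊖ B g) (I∨⁻ (ax (here refl)) (ax (there (here refl))))
  reflect⁻ (~ A)   f        = derive₁ (reflect⊕ A f) (I¬⁻ (ax (here refl)))

  -- If `A ⊕` is missing, the world `A ⁻ ∷ w` forces `A ⁻`, against `f`.
  reflect⊕ A f = decidable-stable em λ ∉ → f _ ≤ʷ-∷ (force⁻ A (∉⊕⇒∈⁻ ∉))
  reflect⊖ A f = decidable-stable em λ ∉ → f _ ≤ʷ-∷ (force⁺ A (∉⊖⇒∈⁺ ∉))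

  force : ∀ P {w} → P ∈ theory w → w ⊩ P
  force (A ⁺) = force⁺ A
  force (A ⁻) = force⁻ A
  force (A ⊕) = force⊕ A
  force (A ⊖) = force⊖ A

  reflect : ∀ P {w} → w ⊩ P → P ∈ theory w
  reflect (A ⁺) = reflect⁺ A
  reflect (A ⁻) = reflect⁻ A
  reflect (A ⊕) = reflect⊕ A
  reflect (A ⊖) = reflect⊖ A

theorem17 : ExcludedMiddle 0ℓ →
    (Γ : Pred Proposition 0ℓ) (P : Proposition) →
    ((M : KripkeModel) (w : KripkeModel.World M) →
    (∀ Q → Q ∈ Γ → M ∋ w ⊩ Q) → M ∋ w ⊩ P) →
    Γ ⊢∞ P
theorem17 em Γ P valid = decidable-stable em λ Γ⊬P →
  let open Lindenbaum em
      open Canonical em (theory em Γ P) (theory-saturated em Γ⊬P)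
        (saturate-extends ⊥ᵖ ∘ inj₁)
        (λ ¬d → saturate-extends ⊥ᵖ (inj₂ (refl , ¬d)))
  -- The root `[]` contains `Γ`, hence forces it; validity and `reflect` then put `P` in a theory
  -- that avoids it.
  in saturate-avoids P Γ⊬P (∈⇒⊢∞ (reflect P
       (valid model [] λ Q Q∈Γ → force Q (saturate-extends P Q∈Γ))))
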